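{- Let $n\ge 0$ be an integer and let $\lambda,\mu\in\mathcal B(n)$. Then $\mathrm{pre}_2(\lambda)=\mathrm{pre}_2(\mu)$ if and only if $\lambda=\mu$.
   Context: A partition $\lambda=(\lambda_1,\dots,\lambda_\ell)$ of $n$ is a weakly decreasing sequence of positive integers with sum $n$, identified with its multiset of parts; $\ell(\lambda)=\ell$ is its length. A binary partition is a partition all of whose parts are powers of $2$ (including $2^0=1$), and $\mathcal B(n)$ is the set of binary partitions of $n$. For a partition $\lambda$ with $\ell(\lambda)\ge2$, $\mathrm{pre}_2(\lambda)$ is the partition whose multiset of parts is $\{\lambda_i\lambda_k\mid 1\le i<k\le\ell(\lambda)\}$ (with multiplicity, one part for each pair $i<k$); if $\ell(\lambda)<2$, $\mathrm{pre}_2(\lambda)=\emptyset$. -}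

module Defs where

open import Data.List.Base using (List; []; _∷_; _++_; map; sum)
open import Data.List.Relation.Binary.Permutation.Propositional using (↭-sym)
open import Data.List.Relation.Binary.Permutation.Propositional.Properties using (All-resp-↭)
open import Data.List.Relation.Unary.All as All using (All; []; _∷_)
open import Data.List.Relation.Unary.All.Properties using (map⁺; ++⁺)
open import Data.List.Relation.Unary.Linked using (Linked)
open import Data.Nat.Base using (ℕ; _*_; _^_; _<_; _≥_)
open import Data.Nat.Properties using (≤-decTotalOrder; *-mono-<)
open import Data.Product.Base using (∃-syntax; _×_)
open import Relation.Binary.Construct.Flip.EqAndOrd using (decTotalOrder)
open import Relation.Binary.PropositionalEquality.Core using (_≡_)
open import Relation.Unary using (Pred)
import Level

open import Data.List.Sort (decTotalOrder ≤-decTotalOrder) using (sort; sort-↭; sort-↗)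

-- The two proof fields are propositions, so `_≡_` on partitions amounts to
-- equality of the weakly decreasing sequences of parts, equivalently of the
-- multisets of parts.
record Partition : Set where
  constructor mkPartition
  field
    parts      : List ℕ
    decreasing : Linked _≥_ parts
    positive   : All (0 <_) parts

open Partition public

size : Partition → ℕ
size p = sum (parts p)

PowerOfTwo : Pred ℕ Level.zero
PowerOfTwo m = ∃[ k ] m ≡ 2 ^ k

𝓑 : ℕ → Pred Partition Level.zero
𝓑 n p = size p ≡ n × All PowerOfTwo (parts p)

-- All xᵢ * xₖ with i < k, one entry per pair of positions; in particular
-- the result is [] when there are fewer than two entries.
pairProducts : List ℕ → List ℕ
pairProducts []       = []
pairProducts (x ∷ xs) = map (x *_) xs ++ pairProducts xs

pairProducts-positive : ∀ {xs} → All (0 <_) xs → All (0 <_) (pairProducts xs)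
pairProducts-positive []         = []
pairProducts-positive (px ∷ pxs) =
  ++⁺ (map⁺ (All.map (*-mono-< px) pxs)) (pairProducts-positive pxs)

pre₂ : Partition → Partition
pre₂ p = record
  { parts      = sort (pairProducts (parts p))
  ; decreasing = sort-↗ (pairProducts (parts p))
  ; positive   = All-resp-↭ (↭-sym (sort-↭ (pairProducts (parts p))))
                            (pairProducts-positive (positive p))
  }

{-# OPTIONS --safe #-}
-- A list of naturals satisfies p_{2N} = p_N² − 2 Σ_{i<k} (xᵢ xₖ)^N, where p_N is
-- the N-th power sum, so pre₂ and p_1 = n determine p_N for every N = 2^k.  These
-- power sums in turn determine a partition: after cancelling equal largest parts,
-- the side with the strictly larger part wins for large N.
module Submission where

open import Defs
open import Data.List.Base using (List; []; _∷_; _++_; length; map)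
open import Data.List.Properties using (map-++; map-id-local)
open import Data.List.Relation.Binary.Permutation.Propositional
  using (_↭_; ↭-sym; ↭-trans; ↭-reflexive)
import Data.List.Relation.Binary.Permutation.Propositional.Properties as ↭
open import Data.List.Relation.Unary.All as All using (All; []; _∷_)
open import Data.List.Relation.Unary.Linked as Linked using (Linked)
open import Data.List.Relation.Unary.Linked.Properties using (Linked⇒All)
open import Data.Nat.Base
open import Data.Nat.ListAction using (sum)
open import Data.Nat.ListAction.Properties using (sum-++; sum-↭)
open import Data.Nat.Properties
open import Relation.Binary.Construct.Flip.EqAndOrd using (decTotalOrder)
open import Data.List.Sort (decTotalOrder ≤-decTotalOrder) using (sort-↭)
open import Data.Nat.Tactic.RingSolver using (solve-∀)
open import Data.Product.Base using (∃-syntax; _,_)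
open import Function.Base using (flip)
open import Function.Bundles using (_⇔_; mk⇔)
open import Relation.Binary.Definitions using (tri<; tri≈; tri>)
open import Relation.Binary.PropositionalEquality
  using (_≡_; refl; sym; trans; cong; cong₂; module ≡-Reasoning)
open import Relation.Nullary.Negation.Core using (contradiction)
open import Relation.Unary using (_∈_)

powerSum : ℕ → List ℕ → ℕ
powerSum N xs = sum (map (_^ N) xs)

powerSum-1 : ∀ xs → powerSum 1 xs ≡ sum xs
powerSum-1 xs = cong sum (map-id-local (All.universal ^-identityʳ xs))

powerSum-++ : ∀ N xs ys → powerSum N (xs ++ ys) ≡ powerSum N xs + powerSum N ys
powerSum-++ N xs ys = trans (cong sum (map-++ (_^ N) xs ys)) (sum-++ (map (_^ N) xs) _)

powerSum-↭ : ∀ N {xs ys} → xs ↭ ys → powerSum N xs ≡ powerSum N ys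
powerSum-↭ N xs↭ys = sum-↭ (↭.map⁺ (_^ N) xs↭ys)

^-distribʳ-* : ∀ N x y → (x * y) ^ N ≡ x ^ N * y ^ N
^-distribʳ-* zero    x y = refl
^-distribʳ-* (suc N) x y = trans (cong (x * y *_) (^-distribʳ-* N x y))
                                 (*-interchange x y (x ^ N) (y ^ N))
  where
  *-interchange : ∀ a b c d → a * b * (c * d) ≡ a * c * (b * d)
  *-interchange = solve-∀

powerSum-map-* : ∀ N x xs → powerSum N (map (x *_) xs) ≡ x ^ N * powerSum N xs
powerSum-map-* N x []       = sym (*-zeroʳ (x ^ N))
powerSum-map-* N x (y ∷ ys) = begin
  (x * y) ^ N + powerSum N (map (x *_) ys)  ≡⟨ cong₂ _+_ (^-distribʳ-* N x y) (powerSum-map-* N x ys) ⟩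
  x ^ N * y ^ N + x ^ N * powerSum N ys     ≡⟨ *-distribˡ-+ (x ^ N) (y ^ N) _ ⟨
  x ^ N * (y ^ N + powerSum N ys)           ∎
  where open ≡-Reasoning

-- Squaring `a + s`, head power plus tail sum, leaves the cross term `2 * (a * s)`, which is twice
-- the contribution of the pairs involving the head. The pair term stands on the right so that no
-- truncated subtraction occurs.
powerSum-square : ∀ N xs →
  powerSum N xs * powerSum N xs ≡ powerSum (2 * N) xs + 2 * powerSum N (pairProducts xs)
powerSum-square N []       = refl
powerSum-square N (x ∷ xs) = begin
  (a + s) * (a + s)
    ≡⟨ expand a s ⟩
  a * a + (s * s + 2 * (a * s))
    ≡⟨ cong₂ (λ u v → u + (v + 2 * (a * s))) x^N*x^N (powerSum-square N xs) ⟩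
  x ^ (2 * N) + (t + 2 * q + 2 * (a * s))
    ≡⟨ regroup (x ^ (2 * N)) t q (a * s) ⟩
  x ^ (2 * N) + t + 2 * (a * s + q)
    ≡⟨ cong (λ u → x ^ (2 * N) + t + 2 * (u + q)) (powerSum-map-* N x xs) ⟨
  x ^ (2 * N) + t + 2 * (powerSum N (map (x *_) xs) + q)
    ≡⟨ cong (λ u → x ^ (2 * N) + t + 2 * u) (powerSum-++ N (map (x *_) xs) _) ⟨
  x ^ (2 * N) + t + 2 * powerSum N (pairProducts (x ∷ xs))
    ∎
  where
  open ≡-Reasoning
  a = x ^ N
  s = powerSum N xs
  t = powerSum (2 * N) xs
  q = powerSum N (pairProducts xs)
  x^N*x^N : a * a ≡ x ^ (2 * N)
  -- `2 * N` unfolds to `N + (N + 0)`, hence the correction by `+-identityʳ`.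
  x^N*x^N = trans (sym (^-distribˡ-+-* x N N)) (cong (λ M → x ^ (N + M)) (sym (+-identityʳ N)))
  expand : ∀ a s → (a + s) * (a + s) ≡ a * a + (s * s + 2 * (a * s))
  expand = solve-∀
  regroup : ∀ b t q r → b + (t + 2 * q + 2 * r) ≡ b + t + 2 * (r + q)
  regroup = solve-∀

-- The square identity passes from exponent `N` to `2 * N`, so starting from the plain sum it
-- reaches exactly the powers of two.
powerSum-2^-determined : ∀ xs ys → sum xs ≡ sum ys → pairProducts xs ↭ pairProducts ys →
  ∀ k → powerSum (2 ^ k) xs ≡ powerSum (2 ^ k) ys
powerSum-2^-determined xs ys sum≡ pairs↭ zero =
  trans (powerSum-1 xs) (trans sum≡ (sym (powerSum-1 ys)))
powerSum-2^-determined xs ys sum≡ pairs↭ (suc k) =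
  -- Both squares agree by induction and both pair terms agree by the permutation, so the latter
  -- cancel.
  +-cancelʳ-≡ (2 * powerSum N (pairProducts xs)) _ _ (begin
    powerSum (2 * N) xs + 2 * powerSum N (pairProducts xs)
      ≡⟨ powerSum-square N xs ⟨
    powerSum N xs * powerSum N xs
      ≡⟨ cong₂ _*_ ih ih ⟩
    powerSum N ys * powerSum N ys
      ≡⟨ powerSum-square N ys ⟩
    powerSum (2 * N) ys + 2 * powerSum N (pairProducts ys)
      ≡⟨ cong (λ u → powerSum (2 * N) ys + 2 * u) (powerSum-↭ N pairs↭) ⟨
    powerSum (2 * N) ys + 2 * powerSum N (pairProducts xs)
      ∎)
  where
  open ≡-Reasoning
  N = 2 ^ k
  ih = powerSum-2^-determined xs ys sum≡ pairs↭ k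

n<2^n : ∀ n → n < 2 ^ n
n<2^n zero    = z<s
n<2^n (suc n) = begin-strict
  suc n          <⟨ s<s (n<2^n n) ⟩
  1 + 2 ^ n      ≤⟨ +-monoˡ-≤ (2 ^ n) (m^n>0 2 n) ⟩
  2 ^ n + 2 ^ n  ≡⟨ cong (2 ^ n +_) (+-identityʳ (2 ^ n)) ⟨
  2 ^ suc n      ∎
  where open ≤-Reasoning

-- Bernoulli's inequality (1 + 1/y)^N ≥ 1 + N/y, cleared of denominators.
bernoulli : ∀ y N → (y + N) * y ^ N ≤ y * suc y ^ N
bernoulli y zero    = ≤-reflexive (cong (_* 1) (+-identityʳ y))
bernoulli y (suc N) = begin
  -- The added slack `N * y ^ N` is what makes the left side factor through `suc y`.
  (y + suc N) * (y * y ^ N)                ≤⟨ m≤m+n _ (N * y ^ N) ⟩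
  (y + suc N) * (y * y ^ N) + N * y ^ N    ≡⟨ factor y N (y ^ N) ⟩
  suc y * ((y + N) * y ^ N)                ≤⟨ *-monoʳ-≤ (suc y) (bernoulli y N) ⟩
  suc y * (y * suc y ^ N)                  ≡⟨ swap y (suc y ^ N) ⟩
  y * (suc y * suc y ^ N)                  ∎
  where
  open ≤-Reasoning
  factor : ∀ y N c → (y + suc N) * (y * c) + N * c ≡ suc y * ((y + N) * c)
  factor = solve-∀
  swap : ∀ y c → suc y * (y * c) ≡ y * (suc y * c)
  swap = solve-∀

-- After multiplying by `y`, Bernoulli leaves only `y * l < y + N` to check, which gives an explicit
-- threshold for `N`.
*-^-<-suc-^ : ∀ l y N .{{_ : NonZero y}} → y * l ≤ N → l * y ^ N < suc y ^ N
*-^-<-suc-^ l y N yl≤N = *-cancelˡ-< y _ _ (begin-strict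
  y * (l * y ^ N)    ≡⟨ *-assoc y l (y ^ N) ⟨
  y * l * y ^ N      <⟨ *-monoˡ-< (y ^ N) {{m^n≢0 y N}} (≤-<-trans yl≤N (m<n+m N (>-nonZero⁻¹ y))) ⟩
  (y + N) * y ^ N    ≤⟨ bernoulli y N ⟩
  y * suc y ^ N      ∎)
  where open ≤-Reasoning

powerSum-≤ : ∀ N {y ys} → All (y ≥_) ys → powerSum N ys ≤ length ys * y ^ N
powerSum-≤ N []           = z≤n
powerSum-≤ N (z≤y ∷ zs≤y) = +-mono-≤ (^-monoˡ-≤ N z≤y) (powerSum-≤ N zs≤y)

-- Every entry of `y ∷ ys` is at most `y`, so its power sum is at most `length (y ∷ ys)` copies of
-- `y ^ N`; for large `N` the single term `x ^ N` exceeds this, as `suc y ≤ x`.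
larger-head-wins : ∀ {x} xs {y ys} → y < x → 0 < y → Linked _≥_ (y ∷ ys) →
  ∃[ k ] powerSum (2 ^ k) (y ∷ ys) < powerSum (2 ^ k) (x ∷ xs)
larger-head-wins {x} xs {y} {ys} y<x 0<y ys↘ = k , (begin-strict
  powerSum N (y ∷ ys)        ≤⟨ powerSum-≤ N (Linked⇒All (flip ≤-trans) ≤-refl ys↘) ⟩
  length (y ∷ ys) * y ^ N    <⟨ *-^-<-suc-^ (length (y ∷ ys)) y N {{>-nonZero 0<y}} (<⇒≤ (n<2^n k)) ⟩
  suc y ^ N                  ≤⟨ ^-monoˡ-≤ N y<x ⟩
  x ^ N                      ≤⟨ m≤m+n (x ^ N) _ ⟩
  powerSum N (x ∷ xs)        ∎)
  where
  open ≤-Reasoning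
  -- The threshold itself serves as `k`, since `k < 2 ^ k`.
  k = y * length (y ∷ ys)
  N = 2 ^ k

powerSum-∷>0 : ∀ N {x} xs → 0 < x → 0 < powerSum N (x ∷ xs)
powerSum-∷>0 N {x} xs 0<x = ≤-trans (m^n>0 x {{>-nonZero 0<x}} N) (m≤m+n (x ^ N) _)

powerSum-injective : ∀ {xs ys} → Linked _≥_ xs → Linked _≥_ ys →
  All (0 <_) xs → All (0 <_) ys →
  (∀ k → powerSum (2 ^ k) xs ≡ powerSum (2 ^ k) ys) → xs ≡ ys
powerSum-injective xs↘ ys↘ [] [] eq = refl
powerSum-injective {ys = _ ∷ ys} xs↘ ys↘ [] (0<y ∷ _) eq =
  -- Index 0 means exponent 1: the empty side sums to 0, the other side is positive.
  contradiction (eq 0) (<⇒≢ (powerSum-∷>0 1 ys 0<y))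
powerSum-injective {xs = _ ∷ xs} xs↘ ys↘ (0<x ∷ _) [] eq =
  contradiction (sym (eq 0)) (<⇒≢ (powerSum-∷>0 1 xs 0<x))
powerSum-injective {x ∷ xs} {y ∷ ys} xs↘ ys↘ (0<x ∷ 0<xs) (0<y ∷ 0<ys) eq
  with <-cmp x y
... | tri< x<y _ _ = let k , lt = larger-head-wins ys x<y 0<x xs↘ in
                     contradiction (eq k) (<⇒≢ lt)
... | tri> _ _ y<x = let k , lt = larger-head-wins xs y<x 0<y ys↘ in
                     contradiction (sym (eq k)) (<⇒≢ lt)
-- Equal heads contribute the same `x ^ (2 ^ k)` for every `k`; cancelling it restores the
-- hypothesis for the tails.
... | tri≈ _ refl _ = cong (x ∷_)
  (powerSum-injective (Linked.tail xs↘) (Linked.tail ys↘) 0<xs 0<ys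
    (λ k → +-cancelˡ-≡ (x ^ (2 ^ k)) _ _ (eq k)))

parts-injective : ∀ {p q} → parts p ≡ parts q → p ≡ q
parts-injective {mkPartition xs xs↘ 0<xs} {mkPartition .xs xs↘′ 0<xs′} refl =
  cong₂ (mkPartition xs) (Linked.irrelevant ≤-irrelevant xs↘ xs↘′)
                         (All.irrelevant ≤-irrelevant 0<xs 0<xs′)

-- Sorting only permutes, so both unsorted lists are permutations of one sorted list.
pre₂-≡⇒↭ : ∀ p q → pre₂ p ≡ pre₂ q → pairProducts (parts p) ↭ pairProducts (parts q)
pre₂-≡⇒↭ p q eq = ↭-trans (↭-sym (sort-↭ _)) (↭-trans (↭-reflexive (cong parts eq)) (sort-↭ _))

proposition2 : (n : ℕ) (p q : Partition) → p ∈ 𝓑 n → q ∈ 𝓑 n →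
    (pre₂ p ≡ pre₂ q) ⇔ (p ≡ q)
proposition2 n p q (size-p , _) (size-q , _) = mk⇔
  (λ eq → parts-injective
    (powerSum-injective (decreasing p) (decreasing q) (positive p) (positive q)
      (powerSum-2^-determined (parts p) (parts q)
        -- The common size `n` supplies the equality of first power sums.
        (trans size-p (sym size-q)) (pre₂-≡⇒↭ p q eq))))
  (cong pre₂)
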